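{- Let $(k,d_1)$ be one of the pairs $(3,3),(3,4),(3,5),(4,3),(5,3)$. Then for no integers $l$ and $d$ with $1<l<k$ and $d\neq d_1$ does a $(k,d_1,d)$-endblock $B(k,l)$ exist.
   Context: All graphs are finite and simple; a planar graph is considered with a fixed plane embedding, and the degree of a face is the length of its boundary walk. A $(k,d_1,d)$-endblock $B(k,l)$ is a $2$-connected plane graph on $n$ vertices such that $n-1$ vertices have degree $k$, one "exceptional" vertex $x_1$ has degree $l$ with $1<l<k$, all faces but one have common degree $d_1$, the remaining face has degree $d\neq d_1$, and $x_1$ lies on the boundary of the face of degree $d$. -}

module Defs where

open import Data.Nat using (ℕ; zero; suc; _+_; _*_; _<_; _≤_)
open import Data.Fin using (Fin)
import Data.Fin as Fin
open import Data.List using (List; length; filter)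
open import Data.Product using (Σ; ∃; _×_; _,_)
open import Relation.Binary.PropositionalEquality using (_≡_; _≢_)
open import Relation.Binary.Construct.Closure.ReflexiveTransitive using (Star)
open import Function.Definitions using (Injective)
open import Function.Base using (_∘_)
open import Data.List.Base using (allFin)

iter : {A : Set} → (A → A) → ℕ → A → A
iter f zero    a = a
iter f (suc k) a = f (iter f k a)

-- A (connected, oriented) combinatorial map / rotation system of a graph with
-- vertex set Fin n, dart set Fin D (D = 2·|E|) and face set Fin F.
--   tail d  : the vertex at which dart d starts
--   α       : the fixed-point-free involution pairing the two darts of an edge
--   σ       : the rotation (cyclic order of darts around each vertex)
--   face d  : the face to the left of dart d; faces are exactly the orbits of
--             φ = σ ∘ α, so the degree of a face = length of its boundary walk.
record Map (n D F : ℕ) : Set where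
  field
    tail   : Fin D → Fin n
    α      : Fin D → Fin D
    σ      : Fin D → Fin D
    face   : Fin D → Fin F
    α-inv  : ∀ d → α (α d) ≡ d
    α-fpf  : ∀ d → α d ≢ d
    σ-inj  : Injective _≡_ _≡_ σ
    vert-orbit  : ∀ d e → (tail d ≡ tail e → ∃ λ j → iter σ j d ≡ e)
                        × ((∃ λ j → iter σ j d ≡ e) → tail d ≡ tail e)
    face-orbit  : ∀ d e → (face d ≡ face e → ∃ λ j → iter (σ ∘ α) j d ≡ e)
                        × ((∃ λ j → iter (σ ∘ α) j d ≡ e) → face d ≡ face e)
    face-surj   : ∀ (f : Fin F) → ∃ λ d → face d ≡ f

module _ {n D F : ℕ} (M : Map n D F) where
  open Map M

  Adj : Fin n → Fin n → Set
  Adj u v = ∃ λ d → tail d ≡ u × tail (α d) ≡ v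

  Simple : Set
  Simple = (∀ d → tail (α d) ≢ tail d)
         × (∀ d e → tail d ≡ tail e → tail (α d) ≡ tail (α e) → d ≡ e)

  Connected : Set
  Connected = ∀ u v → Star Adj u v

  TwoConnected : Set
  TwoConnected = 3 ≤ n × Connected
    × (∀ x u v → u ≢ x → v ≢ x →
         Star (λ a b → Adj a b × a ≢ x × b ≢ x) u v)

  -- plane (genus 0): Euler's formula V - E + F = 2 for the connected map,
  -- with E = D/2, written as 2V + 2F = D + 4
  Plane : Set
  Plane = 2 * n + 2 * F ≡ D + 4

  vdeg : Fin n → ℕ
  vdeg v = length (filter (λ d → tail d Fin.≟ v) (allFin D))

  fdeg : Fin F → ℕ
  fdeg f = length (filter (λ d → face d Fin.≟ f) (allFin D))

IsEndblock : (k d₁ d l : ℕ) → Set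
IsEndblock k d₁ d l =
  Σ ℕ λ n → Σ ℕ λ D → Σ ℕ λ F → Σ (Map n D F) λ M →
    let open Map M in
    Simple M × TwoConnected M × Plane M ×
    (1 < l) × (l < k) × (d ≢ d₁) ×
    Σ (Fin n) λ x₁ → Σ (Fin F) λ f₀ →
      vdeg M x₁ ≡ l × (∀ v → v ≢ x₁ → vdeg M v ≡ k) ×
      fdeg M f₀ ≡ d × (∀ f → f ≢ f₀ → fdeg M f ≡ d₁) ×
      (∃ λ e → tail e ≡ x₁ × face e ≡ f₀)

-- Let S be the Platonic solid of type {d₁, k}. Away from the corner of x₁ in the
-- exceptional face f₀ the endblock is locally isomorphic to S, and the sphere minus that
-- corner is simply connected, so the endblock develops onto S: there is a map g from its
-- darts to those of S compatible with the rotations everywhere but at that corner. The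
-- boundary walk of f₀ develops into a walk around one face of S, while x₁ is
-- surrounded by its l edges, so rotating S about a vertex by l steps (1 < l < k) would
-- preserve a face at that vertex, which is absurd. Only the faces of S matter in this
-- argument, so S may be replaced by a small permutation representation.
--
-- Simple connectivity is obtained from Euler's formula: g is built along a spanning tree
-- of the dual graph rooted at f₀; the remaining edges form a spanning tree of the graph
-- rooted at x₁, and g is compatible with them by induction from the leaves.
module Submission where

open import Defs
open import Data.Empty using (⊥-elim)
open import Data.Fin using (Fin; zero; suc; #_; _≟_; toℕ; fromℕ<)
open import Data.Fin.Properties using (all?; any?; injective⇒≤; toℕ-fromℕ<)
open import Data.List using (List; []; _∷_; [_]; _++_; length; filter; allFin; lookup; applyUpTo)
open import Data.List.Properties using (length-applyUpTo; length-tabulate; length-++)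
open import Data.List.Membership.Propositional using (_∈_; _∉_)
open import Data.List.Membership.Propositional.Properties
  using (∈-lookup; ∈-filter⁺; ∈-filter⁻; ∈-allFin; ∈-applyUpTo⁺; ∈-applyUpTo⁻; ∈-++⁻)
open import Data.List.Membership.Setoid.Properties using (index-injective)
open import Data.List.Relation.Binary.Subset.Propositional using (_⊆_)
import Data.List.Relation.Unary.All as All
open import Data.List.Relation.Unary.All.Properties using (¬Any⇒All¬)
open import Data.List.Relation.Unary.AllPairs using ([]; _∷_)
open import Data.List.Relation.Unary.Any using (here; there; index)
open import Data.List.Relation.Unary.Unique.Propositional using (Unique)
open import Data.List.Relation.Unary.Unique.Propositional.Properties
  using (applyUpTo⁺₁; allFin⁺; filter⁺; ++⁺)
open import Data.Nat using (ℕ; zero; suc; _+_; _*_; _∸_; _<_; _≤_; _<?_; s≤s; z<s; s<s)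
open import Data.Nat.Properties
  using (≤-antisym; ≤-reflexive; ≤-trans; <⇒≤; ≤-pred; ≤∧≢⇒<; <⇒≱; ≮⇒≥; +-comm; +-suc;
         +-cancelʳ-≡; m∸n+n≡m; +-monoʳ-<; <-≤-trans)
open import Data.Nat.Tactic.RingSolver using (solve-∀)
open import Data.Product using (Σ; ∃; _×_; _,_; proj₁; proj₂)
open import Data.Sum using (_⊎_; inj₁; inj₂)
open import Data.Unit using (⊤; tt)
open import Data.Vec as Vec using (Vec; []; _∷_)
open import Function using (_∘_; id; _⇔_; mk⇔; Equivalence)
open import Function.Construct.Composition using (_⇔-∘_)
open import Function.Construct.Identity using (⇔-id)
open import Function.Construct.Symmetry using (⇔-sym)
open import Relation.Binary.Construct.Closure.ReflexiveTransitive using (Star; ε; _◅_)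
open import Relation.Binary.PropositionalEquality
  using (_≡_; _≢_; refl; sym; trans; cong; subst; setoid; module ≡-Reasoning)
open import Relation.Nullary using (¬_; Dec; yes; no; ¬?)
open import Relation.Nullary.Decidable using (from-yes; _×-dec_; _→-dec_; decidable-stable)
open import Relation.Unary using (Decidable)

private variable
  m D : ℕ
  A : Set

-- Iteration and duplicate-free lists.

iter-+ : (f : A → A) (j i : ℕ) (a : A) → iter f (j + i) a ≡ iter f j (iter f i a)
iter-+ f zero    i a = refl
iter-+ f (suc j) i a = cong f (iter-+ f j i a)

iter-comm : (f : A → A) (j : ℕ) (a : A) → iter f j (f a) ≡ f (iter f j a)
iter-comm f zero    a = refl
iter-comm f (suc j) a = cong f (iter-comm f j a)

least : {P : ℕ → Set} → Decidable P → ∀ n → P n → ∃ λ m → P m × (∀ i → i < m → ¬ P i)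
least P? n Pn with P? 0
least P? n       Pn | yes P0 = 0 , P0 , λ _ ()
least P? zero    Pn | no ¬P0 = ⊥-elim (¬P0 Pn)
least P? (suc n) Pn | no ¬P0 with least (P? ∘ suc) n Pn
... | m , Pm , min = suc m , Pm , λ where
  zero    _         → ¬P0
  (suc i) (s≤s i<m) → min i i<m

lookup-injective : {xs : List A} → Unique xs → ∀ i j → lookup xs i ≡ lookup xs j → i ≡ j
lookup-injective (_  ∷ _) zero    zero    _  = refl
lookup-injective (≢s ∷ _) zero    (suc j) eq = ⊥-elim (All.lookup ≢s (∈-lookup j) eq)
lookup-injective (≢s ∷ _) (suc i) zero    eq = ⊥-elim (All.lookup ≢s (∈-lookup i) (sym eq))
lookup-injective (_  ∷ u) (suc i) (suc j) eq = cong suc (lookup-injective u i j eq)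

Unique∧⊆⇒length≤ : {xs ys : List A} → Unique xs → xs ⊆ ys → length xs ≤ length ys
Unique∧⊆⇒length≤ {A = A} u sub = injective⇒≤ {f = λ i → index (sub (∈-lookup i))} λ {i} {j} eq →
  lookup-injective u i j (index-injective (setoid A) (sub (∈-lookup i)) (sub (∈-lookup j)) eq)

Unique⇒length≤ : {xs : List (Fin m)} → Unique xs → length xs ≤ m
Unique⇒length≤ {m} u =
  ≤-trans (Unique∧⊆⇒length≤ u (λ {x} _ → ∈-allFin x)) (≤-reflexive (length-tabulate {n = m} id))

infixr 5 _∷ᵘ_
_∷ᵘ_ : {x : A} {xs : List A} → x ∉ xs → Unique xs → Unique (x ∷ xs)
x∉xs ∷ᵘ u = ¬Any⇒All¬ _ x∉xs ∷ u

module _ {m : ℕ} where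
  open import Data.List.Membership.DecPropositional (_≟_ {m}) public using (_∈?_)

Unique∧length≥⇒full : {xs : List (Fin m)} → Unique xs → m ≤ length xs → ∀ x → x ∈ xs
Unique∧length≥⇒full u m≤ x = decidable-stable (x ∈? _) λ x∉xs →
  <⇒≱ (Unique⇒length≤ (x∉xs ∷ᵘ u)) m≤

-- Orbits of a permutation as cycles.

degree : (Fin D → Fin m) → Fin m → ℕ
degree {D} c v = length (filter (λ x → c x ≟ v) (allFin D))

module Cycle (f : Fin D → Fin D) (c : Fin D → Fin m)
  (orbit : ∀ x y → (c x ≡ c y → ∃ λ j → iter f j x ≡ y) × ((∃ λ j → iter f j x ≡ y) → c x ≡ c y))
  where

  step-cell : ∀ x → c (f x) ≡ c x
  step-cell x = sym (proj₂ (orbit x (f x)) (1 , refl))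

  predecessor : ∀ x → ∃ λ y → f y ≡ x
  predecessor x with proj₁ (orbit (f x) x) (step-cell x)
  ... | j , eq = iter f j x , trans (sym (iter-comm f j x)) eq

  module _ (d : Fin D) where
    private
      y : ℕ → Fin D
      y i = iter f i (f d)

      c-y : ∀ i → c (y i) ≡ c d
      c-y zero    = step-cell d
      c-y (suc i) = trans (step-cell (y i)) (c-y i)

    return-time : ∃ λ M → y M ≡ d × (∀ i → i < M → y i ≢ d)
    return-time with proj₁ (orbit (f d) d) (step-cell d)
    ... | j , eq = least (λ i → y i ≟ d) j eq

    private
      M = proj₁ return-time
      yM≡d = proj₁ (proj₂ return-time)
      M-least = proj₂ (proj₂ return-time)

      cycle : List (Fin D)
      cycle = applyUpTo y (suc M)

      cycle-unique : Unique cycle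
      cycle-unique = applyUpTo⁺₁ y (suc M) λ {i} {j} i<j j<1+M yi≡yj →
        -- A repetition `y i ≡ y j`, pushed forward by `M ∸ j` steps, would bring the walk to `d`
        -- before its first return.
        let M∸j+j≡M = m∸n+n≡m (≤-pred j<1+M) in
        M-least (M ∸ j + i) (<-≤-trans (+-monoʳ-< (M ∸ j) i<j) (≤-reflexive M∸j+j≡M)) (begin
          y (M ∸ j + i)         ≡⟨ iter-+ f (M ∸ j) i (f d) ⟩
          iter f (M ∸ j) (y i)  ≡⟨ cong (iter f (M ∸ j)) yi≡yj ⟩
          iter f (M ∸ j) (y j)  ≡⟨ iter-+ f (M ∸ j) j (f d) ⟨
          y (M ∸ j + j)         ≡⟨ cong y M∸j+j≡M ⟩
          y M                   ≡⟨ yM≡d ⟩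
          d                     ∎)
        where open ≡-Reasoning

      cycle-closed : ∀ {x} → x ∈ cycle → f x ∈ cycle
      cycle-closed {x} x∈ with ∈-applyUpTo⁻ y x∈
      ... | i , i<1+M , refl with y i ≟ d
      ...   | yes yi≡d = subst (λ z → f z ∈ cycle) (sym yi≡d) (∈-applyUpTo⁺ y {n = suc M} z<s)
      ...   | no  yi≢d = ∈-applyUpTo⁺ y (s<s (≤∧≢⇒< (≤-pred i<1+M) λ { refl → yi≢d yM≡d }))

      y∈cycle : ∀ j → y j ∈ cycle
      y∈cycle zero    = ∈-applyUpTo⁺ y {n = suc M} z<s
      y∈cycle (suc j) = cycle-closed (y∈cycle j)

      cell : List (Fin D)
      cell = filter (λ x → c x ≟ c d) (allFin D)

      cell⊆cycle : cell ⊆ cycle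
      cell⊆cycle {x} x∈ with ∈-filter⁻ (λ x → c x ≟ c d) {xs = allFin D} x∈
      ... | _ , cx≡cd with proj₁ (orbit (f d) x) (trans (step-cell d) (sym cx≡cd))
      ...   | j , refl = y∈cycle j

      cycle⊆cell : cycle ⊆ cell
      cycle⊆cell x∈ with ∈-applyUpTo⁻ y x∈
      ... | i , _ , refl = ∈-filter⁺ (λ x → c x ≟ c d) (∈-allFin (y i)) (c-y i)

    degree≡1+M : degree c (c d) ≡ suc M
    degree≡1+M = trans
      (≤-antisym (Unique∧⊆⇒length≤ (filter⁺ (λ x → c x ≟ c d) (allFin⁺ D)) cell⊆cycle)
                 (Unique∧⊆⇒length≤ cycle-unique cycle⊆cell))
      (length-applyUpTo y (suc M))

    -- Induction once round a cycle: the walk from `f d` meets every other dart of the cell before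
    -- it first reaches `d`, so the inductive step is never taken at `d`. One dart of a cell is
    -- thereby controlled by all the others.
    around : (B : ℕ → Fin D → Set) → B 0 (f d) →
      (∀ i x → c x ≡ c d → x ≢ d → B i x → B (suc i) (f x)) →
      ∃ λ k → degree c (c d) ≡ suc k × B k d
    around B base step = M , degree≡1+M , subst (B M) yM≡d (go M (≤-reflexive refl))
      where
      go : ∀ i → i ≤ M → B i (y i)
      go zero    _   = base
      go (suc i) i<M = step i (y i) (c-y i) (M-least i i<M) (go i (<⇒≤ i<M))

  module _ (f-inj : ∀ {x y} → f x ≡ f y → x ≡ y) (p : A → A) (b : Fin D) (a : A) where
    private
      first : ∀ x → c x ≡ c b → ∃ λ j → iter f j b ≡ x × (∀ i → i < j → iter f i b ≢ x)
      first x eq with proj₁ (orbit b x) (sym eq)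
      ... | j , eq′ = least (λ i → iter f i b ≟ x) j eq′

      time : Fin D → ℕ
      time x with c x ≟ c b
      ... | yes eq = proj₁ (first x eq)
      -- A default value: `unroll` constrains `h` only on the cell of `b`.
      ... | no  _  = 0

      time-least : ∀ x → c x ≡ c b → iter f (time x) b ≡ x × (∀ i → i < time x → iter f i b ≢ x)
      time-least x eq with c x ≟ c b
      ... | yes eq′ = proj₂ (first x eq′)
      ... | no  neq = ⊥-elim (neq eq)

      time-unique : ∀ x → c x ≡ c b → ∀ j → iter f j b ≡ x → (∀ i → i < j → iter f i b ≢ x) → time x ≡ j
      time-unique x eq j hit min with time-least x eq
      ... | hit′ , min′ = ≤-antisym (≮⇒≥ λ j<t → min′ j j<t hit) (≮⇒≥ λ t<j → min (time x) t<j hit′)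

      time-base : time b ≡ 0
      time-base = time-unique b refl 0 refl λ _ ()

      time-step : ∀ x → c x ≡ c b → f x ≢ b → time (f x) ≡ suc (time x)
      time-step x eq fx≢b with time-least x eq
      ... | hit , min = time-unique (f x) (trans (step-cell x) eq) (suc (time x)) (cong f hit) λ where
        zero    _         b≡fx → fx≢b (sym b≡fx)
        (suc i) (s≤s i<t) eq′  → min i i<t (f-inj eq′)

    -- `h` applies `p` as many times as there are steps from `b`. The only possible defect is where
    -- the cycle closes, and it vanishes when `p` iterated over the degree fixes `a`.
    unroll : Σ (Fin D → A) λ h → h b ≡ a
      × (∀ x → c x ≡ c b → f x ≢ b → h (f x) ≡ p (h x))
      × (iter p (degree c (c b)) a ≡ a → ∀ x → c x ≡ c b → h (f x) ≡ p (h x))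
    unroll = h , h-base , h-step , h-closed
      where
      h : Fin D → A
      h x = iter p (time x) a

      h-base : h b ≡ a
      h-base = cong (λ t → iter p t a) time-base

      h-step : ∀ x → c x ≡ c b → f x ≢ b → h (f x) ≡ p (h x)
      h-step x eq fx≢b = cong (λ t → iter p t a) (time-step x eq fx≢b)

      h-closed : iter p (degree c (c b)) a ≡ a → ∀ x → c x ≡ c b → h (f x) ≡ p (h x)
      h-closed period x eq with f x ≟ b
      ... | no fx≢b = h-step x eq fx≢b
      ... | yes fx≡b with around x (λ i z → time z ≡ i) (trans (cong time fx≡b) time-base)
              (λ i z cz≡cx z≢x ti → trans
                (time-step z (trans cz≡cx eq) (λ fz≡b → z≢x (f-inj (trans fz≡b (sym fx≡b)))))
                (cong suc ti))
      ...   | k , deg , tx≡k = begin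
              h (f x)                     ≡⟨ cong h fx≡b ⟩
              h b                         ≡⟨ h-base ⟩
              a                           ≡⟨ period ⟨
              iter p (degree c (c b)) a   ≡⟨ cong (λ v → iter p (degree c v) a) eq ⟨
              iter p (degree c (c x)) a   ≡⟨ cong (λ n → iter p n a) deg ⟩
              p (iter p k a)              ≡⟨ cong (λ t → p (iter p t a)) tx≡k ⟨
              p (h x)                     ∎
        where open ≡-Reasoning

-- Spanning trees and induction from their leaves.

module Growth (α : Fin D → Fin D) (α-inv : ∀ x → α (α x) ≡ x)
  (c : Fin D → Fin m) (r : Fin m) {P : Fin D → Set} where

  -- Spanning-tree growth from r along edges satisfying P: the indices list
  -- the cells reached and the darts used.
  data Grow : List (Fin m) → List (Fin D) → Set where
    root : Grow [ r ] []
    step : ∀ {vs ts} → Grow vs ts → ∀ t → P t → c t ∈ vs → c (α t) ∉ vs →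
           Grow (c (α t) ∷ vs) (t ∷ α t ∷ ts)

  private variable
    vs : List (Fin m)
    ts : List (Fin D)

  root∈ : Grow vs ts → r ∈ vs
  root∈ root             = here refl
  root∈ (step G _ _ _ _) = there (root∈ G)

  ends∈ : Grow vs ts → ∀ {x} → x ∈ ts → c x ∈ vs × c (α x) ∈ vs
  ends∈ (step G t _ ct∈ _) (here refl)         = there ct∈ , here refl
  ends∈ (step G t _ ct∈ _) (there (here refl)) =
    here refl , there (subst (λ z → c z ∈ _) (sym (α-inv t)) ct∈)
  ends∈ (step G t _ _ _)   (there (there x∈))  =
    there (proj₁ (ends∈ G x∈)) , there (proj₂ (ends∈ G x∈))

  α-closed : Grow vs ts → ∀ {x} → x ∈ ts → α x ∈ ts
  α-closed (step G t _ _ _) (here refl)         = there (here refl)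
  α-closed (step G t _ _ _) (there (here refl)) = here (α-inv t)
  α-closed (step G t _ _ _) (there (there x∈))  = there (there (α-closed G x∈))

  darts-P : (∀ {x} → P x → P (α x)) → Grow vs ts → ∀ {x} → x ∈ ts → P x
  darts-P Pα (step G t Pt _ _) (here refl)         = Pt
  darts-P Pα (step G t Pt _ _) (there (here refl)) = Pα Pt
  darts-P Pα (step G t _ _ _)  (there (there x∈))  = darts-P Pα G x∈

  cells-unique : Grow vs ts → Unique vs
  cells-unique root               = (λ ()) ∷ᵘ []
  cells-unique (step G _ _ _ new) = new ∷ᵘ cells-unique G

  darts-unique : Grow vs ts → Unique ts
  darts-unique root = []
  darts-unique (step {vs} G t _ ct∈ new) =
    (λ { (here t≡αt) → new (subst (λ z → c z ∈ vs) t≡αt ct∈)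
       ; (there t∈)  → new (proj₂ (ends∈ G t∈)) })
    ∷ᵘ (new ∘ proj₁ ∘ ends∈ G) ∷ᵘ darts-unique G

  darts-length : Grow vs ts → length ts + 2 ≡ 2 * length vs
  darts-length root = refl
  darts-length (step {vs} G _ _ _ _) =
    trans (cong (2 +_) (darts-length G)) (double-suc (length vs))
    where
    double-suc : ∀ v → 2 + 2 * v ≡ 2 * suc v
    double-suc = solve-∀

  spanning-length : Grow vs ts → (∀ v → v ∈ vs) → length ts + 2 ≡ 2 * m
  spanning-length {vs} G all∈ = trans (darts-length G) (cong (2 *_)
    (≤-antisym (Unique⇒length≤ (cells-unique G)) (≤-trans (≤-reflexive (sym (length-tabulate {n = m} id)))
      (Unique∧⊆⇒length≤ (allFin⁺ m) (λ {x} _ → all∈ x)))))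

  -- Greedy growth, which stops because no cell is repeated and there are only `m`. When no edge can
  -- be added, the cells reached are closed under the edges in `P`, and `cut` says that they are
  -- all.
  spanning : Decidable P →
    (∀ vs → r ∈ vs → (∀ t → P t → c t ∈ vs → c (α t) ∈ vs) → ∀ v → v ∈ vs) →
    ∃ λ vs → ∃ λ ts → Grow vs ts × (∀ v → v ∈ vs)
  spanning P? cut = go m root (≤-reflexive (+-comm 1 m))
    where
    go : ∀ fuel {vs ts} → Grow vs ts → m < fuel + length vs →
      ∃ λ vs → ∃ λ ts → Grow vs ts × (∀ v → v ∈ vs)
    go zero G m<len = ⊥-elim (<⇒≱ m<len (Unique⇒length≤ (cells-unique G)))
    go (suc fuel) {vs} G m<len
      with any? (λ t → P? t ×-dec (c t ∈? vs) ×-dec ¬? (c (α t) ∈? vs))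
    ... | yes (t , Pt , ct∈ , new) =
      go fuel (step G t Pt ct∈ new) (subst (m <_) (sym (+-suc fuel (length vs))) m<len)
    ... | no none = _ , _ , G , cut vs (root∈ G) λ t Pt ct∈ →
      decidable-stable (c (α t) ∈? vs) λ new → none (t , Pt , ct∈ , new)

  -- The cell attached last is a leaf, so its only tree dart is forced by the others.
  peel : {Q : Fin D → Set} → (∀ {x} → Q x → Q (α x)) →
    (∀ x → c x ≢ r → (∀ y → c y ≡ c x → y ≢ x → Q y) → Q x) →
    Grow vs ts → (∀ x → x ∉ ts → Q x) → ∀ x → Q x
  peel Qα closing root off x = off x λ ()
  peel {Q = Q} Qα closing (step {vs} {ts} G t _ ct∈ new) off = peel Qα closing G off′
    where
    Qαt : Q (α t)
    Qαt = closing (α t) (λ eq → new (subst (_∈ vs) (sym eq) (root∈ G))) λ y cy≡ y≢ → off y λ where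
      (here refl)         → new (subst (_∈ vs) cy≡ ct∈)
      (there (here y≡))   → y≢ y≡
      (there (there y∈))  → new (subst (_∈ vs) cy≡ (proj₁ (ends∈ G y∈)))

    off′ : ∀ x → x ∉ ts → Q x
    off′ x x∉ with x ≟ t | x ≟ α t
    ... | yes refl | _        = subst Q (α-inv t) (Qα Qαt)
    ... | no _     | yes refl = Qαt
    ... | no x≢t   | no x≢αt  = off x λ where
      (here eq)          → x≢t eq
      (there (here eq))  → x≢αt eq
      (there (there x∈)) → x∉ x∈

-- Developing an endblock onto a Platonic solid.

-- A set with an action of the rotation group of the Platonic solid of type
-- {d₁, k}: a is a half turn about an edge, s a rotation about a vertex and s ∘ a
-- one about a face, which fixes the point o.
record PlatonicAction (k d₁ : ℕ) : Set₁ where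
  field
    X       : Set
    a s     : X → X
    o       : X
    a-order : ∀ x → a (a x) ≡ x
    s-order : ∀ x → iter s k x ≡ x
    p-order : ∀ x → iter (s ∘ a) d₁ x ≡ x
    p-fix   : s (a o) ≡ o
    s-free  : ∀ l → 1 < l → l < k → iter s l o ≢ o

module Holonomy {n D F k d₁ l : ℕ} (M : Map n D F) (connected : Connected M) (plane : Plane M)
  (e : Fin D) (deg-x₁ : vdeg M (Map.tail M e) ≡ l)
  (deg-v : ∀ v → v ≢ Map.tail M e → vdeg M v ≡ k)
  (deg-f : ∀ f → f ≢ Map.face M e → fdeg M f ≡ d₁)
  (action : PlatonicAction k d₁)
  where

  open Map M
  open PlatonicAction action

  p : X → X
  p = s ∘ a

  φ : Fin D → Fin D
  φ = σ ∘ α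

  α-inj : ∀ {x y} → α x ≡ α y → x ≡ y
  α-inj {x} {y} eq = trans (sym (α-inv x)) (trans (cong α eq) (α-inv y))

  φ-inj : ∀ {x y} → φ x ≡ φ y → x ≡ y
  φ-inj = α-inj ∘ σ-inj

  φ∘α : ∀ x → φ (α x) ≡ σ x
  φ∘α x = cong σ (α-inv x)

  module V = Cycle σ tail vert-orbit
  module Φ = Cycle φ face face-orbit
  module FaceGrowth = Growth α α-inv face (face e) {P = λ _ → ⊤}

  connected-induction : (R : Fin n → Set) → R (tail e) →
    (∀ x → R (tail x) → R (tail (α x))) → ∀ v → R v
  connected-induction R base step v = go (connected (tail e) v) base
    where
    go : ∀ {u w} → Star (Adj M) u w → R u → R w
    go ε                         Ru = Ru
    go ((x , refl , refl) ◅ u⇝w) Ru = go u⇝w (step x Ru)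

  -- The dual graph is connected: `σ y` is `φ (α y)` and so lies in the face of `α y`; hence closure
  -- under crossing edges spreads from one dart to all darts at its vertex, and then along edges.
  face-cut : ∀ fs → face e ∈ fs → (∀ t → ⊤ → face t ∈ fs → face (α t) ∈ fs) → ∀ f → f ∈ fs
  face-cut fs e∈ closed f with face-surj f
  ... | x , refl = connected-induction R (σ-closed e∈) step (tail x) x refl
    where
    R : Fin n → Set
    R v = ∀ y → tail y ≡ v → face y ∈ fs

    iter-closed : ∀ j {y} → face y ∈ fs → face (iter σ j y) ∈ fs
    iter-closed zero    y∈ = y∈
    iter-closed (suc j) {y} y∈ = subst (_∈ fs)
      (trans (sym (Φ.step-cell (α z))) (cong face (φ∘α z)))
      (closed z tt (iter-closed j y∈))
      where z = iter σ j y

    σ-closed : ∀ {y} → face y ∈ fs → R (tail y)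
    σ-closed {y} y∈ z eq with proj₁ (vert-orbit y z) (sym eq)
    ... | j , refl = iter-closed j y∈

    step : ∀ y → R (tail y) → R (tail (α y))
    step y Ry = σ-closed (closed y tt (Ry y refl))

  -- A developing map on the faces reached so far, with the root face cut open at the corner before
  -- `e`. Compatibility with `α` is demanded on tree edges only; across the others it has to be
  -- proved.
  Developed : List (Fin F) → List (Fin D) → (Fin D → X) → Set
  Developed fs ts g = g e ≡ o
    × (∀ y → face y ∈ fs → φ y ≢ e → g (φ y) ≡ p (g y))
    × (∀ y → y ∈ ts → g (α y) ≡ a (g y))

  -- The cut lets the root face have any degree. Each further face is entered through `α t` with the
  -- value forced by the tree edge, and closes up because its degree is `d₁` and `p` iterated `d₁`
  -- times is the identity.
  develop : ∀ {fs ts} → FaceGrowth.Grow fs ts → ∃ (Developed fs ts)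
  develop FaceGrowth.root with Φ.unroll φ-inj p e o
  ... | h , h-base , h-step , _ = h , h-base , (λ { y (here eq) → h-step y eq }) , λ _ ()
  develop (FaceGrowth.step {fs} {ts} G t _ t∈ new) with develop G
  ... | g , g-base , g-step , g-tree with Φ.unroll φ-inj p (α t) (a (g t))
  ... | h , h-base , _ , h-closed = g′ , trans (g′-old e e∈) g-base , g′-step , g′-tree
    where
    e∈ : face e ∈ fs
    e∈ = FaceGrowth.root∈ G

    g′ : Fin D → X
    g′ y with face y ≟ face (α t)
    ... | yes _ = h y
    ... | no  _ = g y

    g′-new : ∀ y → face y ≡ face (α t) → g′ y ≡ h y
    g′-new y eq with face y ≟ face (α t)
    ... | yes _  = refl
    ... | no neq = ⊥-elim (neq eq)

    g′-old : ∀ y → face y ∈ fs → g′ y ≡ g y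
    g′-old y y∈ with face y ≟ face (α t)
    ... | yes eq = ⊥-elim (new (subst (_∈ fs) eq y∈))
    ... | no _   = refl

    period : iter p (degree face (face (α t))) (a (g t)) ≡ a (g t)
    period = trans
      (cong (λ i → iter p i (a (g t))) (deg-f (face (α t)) λ eq → new (subst (_∈ fs) (sym eq) e∈)))
      (p-order (a (g t)))

    g′-step : ∀ y → face y ∈ face (α t) ∷ fs → φ y ≢ e → g′ (φ y) ≡ p (g′ y)
    g′-step y (here eq) _ = trans (g′-new (φ y) (trans (Φ.step-cell y) eq))
      (trans (h-closed period y eq) (cong p (sym (g′-new y eq))))
    g′-step y (there y∈) φy≢e = trans (g′-old (φ y) (subst (_∈ fs) (sym (Φ.step-cell y)) y∈))
      (trans (g-step y y∈ φy≢e) (cong p (sym (g′-old y y∈))))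

    g′-t : g′ (α t) ≡ a (g′ t)
    g′-t = trans (g′-new (α t) refl) (trans h-base (cong a (sym (g′-old t t∈))))

    g′-tree : ∀ y → y ∈ t ∷ α t ∷ ts → g′ (α y) ≡ a (g′ y)
    g′-tree y (here refl)         = g′-t
    g′-tree y (there (here refl)) = trans (cong g′ (α-inv t))
      (trans (sym (a-order (g′ t))) (cong a (sym g′-t)))
    g′-tree y (there (there y∈)) with FaceGrowth.ends∈ G y∈
    ... | y∈fs , αy∈fs = trans (g′-old (α y) αy∈fs)
      (trans (g-tree y y∈) (cong a (sym (g′-old y y∈fs))))

  -- The complementary tree and Euler's formula.

  module _ {fs ts} (G : FaceGrowth.Grow fs ts) (all-faces : ∀ f → f ∈ fs) where

    module VertexGrowth = Growth α α-inv tail (tail e) {P = _∉ ts}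

    cotree-α : ∀ {x} → x ∉ ts → α x ∉ ts
    cotree-α x∉ αx∈ = x∉ (subst (_∈ ts) (α-inv _) (FaceGrowth.α-closed G αx∈))

    -- If only edges of the dual tree leave vs then none does: a leaf face of the
    -- dual tree would be left with exactly one crossing edge on its boundary walk.
    vertex-cut : ∀ vs → tail e ∈ vs → (∀ t → t ∉ ts → tail t ∈ vs → tail (α t) ∈ vs) → ∀ v → v ∈ vs
    vertex-cut vs e∈ closed =
      connected-induction (_∈ vs) e∈ (λ x → Equivalence.to (no-crossing x))
      where
      NonCrossing : Fin D → Set
      NonCrossing x = tail x ∈ vs ⇔ tail (α x) ∈ vs

      nonCrossing-α : ∀ {x} → NonCrossing x → NonCrossing (α x)
      nonCrossing-α {x} N = subst (λ z → tail (α x) ∈ vs ⇔ tail z ∈ vs) (sym (α-inv x)) (⇔-sym N)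

      boundary-walk : ∀ x → face x ≢ face e → (∀ y → face y ≡ face x → y ≢ x → NonCrossing y) →
        NonCrossing x
      -- `φ x` has the same tail as `α x`, so the walk from `φ x` back to `x` ties the two ends of
      -- `x` together.
      boundary-walk x _ others with Φ.around x (λ _ y → tail y ∈ vs ⇔ tail (α x) ∈ vs)
        (subst (λ v → v ∈ vs ⇔ tail (α x) ∈ vs) (sym (V.step-cell (α x))) (⇔-id _))
        (λ _ y fy≡ y≢x N → subst (λ v → v ∈ vs ⇔ tail (α x) ∈ vs) (sym (V.step-cell (α y)))
          (N ⇔-∘ ⇔-sym (others y fy≡ y≢x)))
      ... | _ , _ , N = N

      no-crossing : ∀ x → NonCrossing x
      no-crossing = FaceGrowth.peel nonCrossing-α boundary-walk G λ x x∉ →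
        mk⇔ (closed x x∉) λ αx∈ →
          subst (λ z → tail z ∈ vs) (α-inv x) (closed (α x) (cotree-α x∉) αx∈)

    cotree : ∃ λ vs → ∃ λ ts′ → VertexGrowth.Grow vs ts′ × (∀ v → v ∈ vs)
    cotree = VertexGrowth.spanning (λ x → ¬? (x ∈? ts)) vertex-cut

    -- Euler's formula: the two trees together use 2(n - 1) + 2(F - 1) = D darts.
    cotree-full : ∀ {vs ts′} → VertexGrowth.Grow vs ts′ → (∀ v → v ∈ vs) → ∀ x → x ∉ ts′ → x ∈ ts
    cotree-full {vs} {ts′} G′ all-vertices x x∉ts′ with ∈-++⁻ ts′ (Unique∧length≥⇒full
      (++⁺ (VertexGrowth.darts-unique G′) (FaceGrowth.darts-unique G)
        λ (x∈ts′ , x∈ts) → VertexGrowth.darts-P cotree-α G′ x∈ts′ x∈ts)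
      (≤-reflexive (sym total)) x)
      where
      shuffle : ∀ x y → (x + y) + 4 ≡ (x + 2) + (y + 2)
      shuffle = solve-∀

      total : length (ts′ ++ ts) ≡ D
      total = +-cancelʳ-≡ 4 _ _ (begin
        length (ts′ ++ ts) + 4                 ≡⟨ cong (_+ 4) (length-++ ts′) ⟩
        (length ts′ + length ts) + 4           ≡⟨ shuffle (length ts′) (length ts) ⟩
        (length ts′ + 2) + (length ts + 2)     ≡⟨ cong (_+ (length ts + 2)) (VertexGrowth.spanning-length G′ all-vertices) ⟩
        2 * n + (length ts + 2)                ≡⟨ cong (2 * n +_) (FaceGrowth.spanning-length G all-faces) ⟩
        2 * n + 2 * F                          ≡⟨ plane ⟩
        D + 4                                  ∎)
        where open ≡-Reasoning
    ... | inj₁ x∈ts′ = ⊥-elim (x∉ts′ x∈ts′)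
    ... | inj₂ x∈ts  = x∈ts

    -- Equivariance and holonomy.

    module _ {g : Fin D → X} (dev : Developed fs ts g) where
      private
        g-base = proj₁ dev

        g-step : ∀ y → φ y ≢ e → g (φ y) ≡ p (g y)
        g-step y = proj₁ (proj₂ dev) y (all-faces (face y))

      Equivariant : Fin D → Set
      Equivariant y = g (α y) ≡ a (g y)

      equivariant-α : ∀ {y} → Equivariant y → Equivariant (α y)
      equivariant-α {y} eq = trans (cong g (α-inv y)) (trans (sym (a-order (g y))) (cong a (sym eq)))

      -- `σ` is `φ ∘ α`, so it acts as `s ∘ a ∘ a`; only the cut corner escapes.
      rotate : ∀ y → Equivariant y → σ y ≢ e → g (σ y) ≡ s (g y)
      rotate y eq σy≢e = begin
        g (σ y)          ≡⟨ cong g (φ∘α y) ⟨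
        g (φ (α y))      ≡⟨ g-step (α y) (σy≢e ∘ trans (sym (φ∘α y))) ⟩
        s (a (g (α y)))  ≡⟨ cong (s ∘ a) eq ⟩
        s (a (a (g y)))  ≡⟨ cong s (a-order (g y)) ⟩
        s (g y)          ∎
        where open ≡-Reasoning

      -- The face through `α x` and `σ x` gives the value at `σ x`. Rotating from there to `x` takes
      -- `k - 1` steps, and since `s` iterated `k` times is the identity, the relation across `x`
      -- follows.
      around-vertex : ∀ x → tail x ≢ tail e → (∀ y → tail y ≡ tail x → y ≢ x → Equivariant y) →
        Equivariant x
      around-vertex x x≢ others with V.around x (λ i y → g y ≡ iter s i (g (σ x))) refl
        (λ i y ty≡ y≢x eq → trans
          (rotate y (others y ty≡ y≢x) λ σy≡e →
            x≢ (trans (sym ty≡) (trans (sym (V.step-cell y)) (cong tail σy≡e))))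
          (cong s eq))
      ... | i , deg , gx≡ = begin
        g (α x)                        ≡⟨ a-order _ ⟨
        a (a (g (α x)))                ≡⟨ cong a (s-order _) ⟨
        a (iter s k (a (g (α x))))     ≡⟨ cong (λ j → a (iter s j (a (g (α x))))) k≡ ⟩
        a (s (iter s i (a (g (α x))))) ≡⟨ cong a (iter-comm s i _) ⟨
        a (iter s i (p (g (α x))))     ≡⟨ cong (a ∘ iter s i) (g-step (α x) φαx≢e) ⟨
        a (iter s i (g (φ (α x))))     ≡⟨ cong (a ∘ iter s i ∘ g) (φ∘α x) ⟩
        a (iter s i (g (σ x)))         ≡⟨ cong a gx≡ ⟨
        a (g x)                        ∎
        where
        open ≡-Reasoning
        k≡ : k ≡ suc i
        k≡ = trans (sym (deg-v (tail x) x≢)) deg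
        φαx≢e : φ (α x) ≢ e
        φαx≢e eq = x≢ (trans (sym (V.step-cell x)) (cong tail (trans (sym (φ∘α x)) eq)))

      -- Every edge outside the vertex tree is in the dual tree, where the relation was built in;
      -- the edges of the vertex tree follow leaf by leaf.
      equivariant : ∀ x → Equivariant x
      equivariant with cotree
      ... | vs , ts′ , G′ , all-vertices = VertexGrowth.peel equivariant-α around-vertex G′
        λ x x∉ → proj₂ (proj₂ dev) x (cotree-full G′ all-vertices x x∉)

      -- e and b = σ⁻¹ e bound the corner of x₁ in the face f₀: going
      -- round f₀ gives g (α b) = o, and round x₁ gives g b = s^(l-1) o.
      s^l-fixes-o : iter s l o ≡ o
      s^l-fixes-o with V.predecessor e
      ... | b , σb≡e
        with V.around b (λ i y → g y ≡ iter s i o) (trans (cong g σb≡e) g-base)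
               (λ i y _ y≢b eq → trans
                 (rotate y (equivariant y) (λ σy≡e → y≢b (σ-inj (trans σy≡e (sym σb≡e)))))
                 (cong s eq))
           | Φ.around (α b) (λ _ y → g y ≡ o) (trans (cong g φαb≡e) g-base)
               (λ _ y _ y≢αb eq → trans
                 (g-step y (λ φy≡e → y≢αb (φ-inj (trans φy≡e (sym φαb≡e)))))
                 (trans (cong p eq) p-fix))
        where
        φαb≡e : φ (α b) ≡ e
        φαb≡e = trans (φ∘α b) σb≡e
      ... | i , deg , gb≡ | _ , _ , gαb≡ = begin
        iter s l o          ≡⟨ cong (λ j → iter s j o) l≡ ⟩
        s (iter s i o)      ≡⟨ cong s gb≡ ⟨
        s (g b)             ≡⟨ cong s (a-order (g b)) ⟨
        s (a (a (g b)))     ≡⟨ cong p (equivariant b) ⟨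
        p (g (α b))         ≡⟨ cong p gαb≡ ⟩
        p o                 ≡⟨ p-fix ⟩
        o                   ∎
        where
        open ≡-Reasoning
        l≡ : l ≡ suc i
        l≡ = trans (sym deg-x₁) (trans
          (cong (vdeg M) (trans (sym (cong tail σb≡e)) (V.step-cell b))) deg)

  holonomy : iter s l o ≡ o
  holonomy with FaceGrowth.spanning (λ _ → yes tt) face-cut
  ... | _ , _ , G , all-faces with develop G
  ... | _ , dev = s^l-fixes-o G all-faces dev

no-endblock : ∀ {k d₁ d l} → PlatonicAction k d₁ → ¬ IsEndblock k d₁ d l
-- The corner at `e` identifies the exceptional vertex with `tail e` and the exceptional face with
-- `face e`.
no-endblock {k} {d₁} {d} {l} action
  (n , D , F , M , _ , (_ , connected , _) , plane , 1<l , l<k , _ ,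
   _ , _ , deg-x₁ , deg-v , _ , deg-f , e , refl , refl) =
  PlatonicAction.s-free action l 1<l l<k
    (Holonomy.holonomy M connected plane e deg-x₁ deg-v deg-f action)

-- Permutation tables for the five solids.

module _ {N : ℕ} (a s : Vec (Fin (suc N)) (suc N)) (k d₁ : ℕ) where
  private
    a′ s′ : Fin (suc N) → Fin (suc N)
    a′ = Vec.lookup a
    s′ = Vec.lookup s

  -- Every clause ranges over a finite type, so evaluation decides it. The fixed point `o` is
  -- numbered `zero`, and freeness is put contrapositively: an exponent below `k` that fixes it is 0
  -- or 1.
  IsAction : Set
  IsAction = (∀ x → a′ (a′ x) ≡ x) × (∀ x → iter s′ k x ≡ x) × (∀ x → iter (s′ ∘ a′) d₁ x ≡ x)
    × s′ (a′ zero) ≡ zero × (∀ (l : Fin k) → iter s′ (toℕ l) zero ≡ zero → toℕ l < 2)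

  isAction? : Dec IsAction
  isAction? = all? (λ x → a′ (a′ x) ≟ x) ×-dec all? (λ x → iter s′ k x ≟ x)
    ×-dec all? (λ x → iter (s′ ∘ a′) d₁ x ≟ x) ×-dec (s′ (a′ zero) ≟ zero)
    ×-dec all? (λ (l : Fin k) → (iter s′ (toℕ l) zero ≟ zero) →-dec (toℕ l <? 2))

  tableAction : IsAction → PlatonicAction k d₁
  tableAction (a-order , s-order , p-order , p-fix , free) = record
    { a = a′ ; s = s′ ; o = zero
    ; a-order = a-order ; s-order = s-order ; p-order = p-order ; p-fix = p-fix
    ; s-free = λ l 1<l l<k fix → <⇒≱ 1<l (≤-pred (subst (_< 2) (toℕ-fromℕ< l<k)
        (free (fromℕ< l<k) (trans (cong (λ i → iter s′ i zero) (toℕ-fromℕ< l<k)) fix))))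
    }

-- A₄ on 4 points.
tetrahedron : PlatonicAction 3 3
tetrahedron = tableAction a s 3 3 (from-yes (isAction? a s 3 3))
  where
  a = # 2 ∷ # 3 ∷ # 0 ∷ # 1 ∷ []
  s = # 1 ∷ # 2 ∷ # 0 ∷ # 3 ∷ []

-- S₄ through its quotient S₃.
cube : PlatonicAction 3 4
cube = tableAction a s 3 4 (from-yes (isAction? a s 3 4))
  where
  a = # 2 ∷ # 1 ∷ # 0 ∷ []
  s = # 1 ∷ # 2 ∷ # 0 ∷ []

-- A₅ on the 6 axes through opposite faces.
dodecahedron : PlatonicAction 3 5
dodecahedron = tableAction a s 3 5 (from-yes (isAction? a s 3 5))
  where
  a = # 2 ∷ # 3 ∷ # 0 ∷ # 1 ∷ # 4 ∷ # 5 ∷ []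
  s = # 1 ∷ # 2 ∷ # 0 ∷ # 4 ∷ # 5 ∷ # 3 ∷ []

-- S₄ on 4 points.
octahedron : PlatonicAction 4 3
octahedron = tableAction a s 4 3 (from-yes (isAction? a s 4 3))
  where
  a = # 3 ∷ # 1 ∷ # 2 ∷ # 0 ∷ []
  s = # 1 ∷ # 2 ∷ # 3 ∷ # 0 ∷ []

-- A₅ on 5 points.
icosahedron : PlatonicAction 5 3
icosahedron = tableAction a s 5 3 (from-yes (isAction? a s 5 3))
  where
  a = # 4 ∷ # 2 ∷ # 1 ∷ # 3 ∷ # 0 ∷ []
  s = # 1 ∷ # 2 ∷ # 3 ∷ # 4 ∷ # 0 ∷ []

theorem17 : (k d₁ : ℕ) →
    ((k ≡ 3 × d₁ ≡ 3) ⊎ (k ≡ 3 × d₁ ≡ 4) ⊎ (k ≡ 3 × d₁ ≡ 5) ⊎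
    (k ≡ 4 × d₁ ≡ 3) ⊎ (k ≡ 5 × d₁ ≡ 3)) →
    (l d : ℕ) → 1 < l → l < k → d ≢ d₁ → ¬ IsEndblock k d₁ d l
theorem17 _ _ (inj₁ (refl , refl))                      _ _ _ _ _ = no-endblock tetrahedron
theorem17 _ _ (inj₂ (inj₁ (refl , refl)))               _ _ _ _ _ = no-endblock cube
theorem17 _ _ (inj₂ (inj₂ (inj₁ (refl , refl))))        _ _ _ _ _ = no-endblock dodecahedron
theorem17 _ _ (inj₂ (inj₂ (inj₂ (inj₁ (refl , refl))))) _ _ _ _ _ = no-endblock octahedron
theorem17 _ _ (inj₂ (inj₂ (inj₂ (inj₂ (refl , refl))))) _ _ _ _ _ = no-endblock icosahedron
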